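{- Let $(A_i,\gamma_i)_{i\in I}$, with $I\neq\varnothing$, be a family of non-trivial quasiordered sets, i.e. $\Delta_{A_i}\neq\gamma_i\neq A_i\times A_i$ for all $i\in I$. Then the following are equivalent: (1) $\prod_{i\in I}\gamma_i$ is a half-space on $\prod_{i\in I}A_i$; (2) either $|I|=1$ and the single $\gamma_i$ is a half-space, or $|I|=2$ and both $(A_i,\gamma_i)$ are two-element chains.
   Context: A quasiorder on $A$ is a reflexive and transitive relation; $\Delta_A=\{(a,a)\mid a\in A\}$. A quasiorder $\alpha$ on $A$ is a half-space if there is a quasiorder $\beta$ on $A$ with $\alpha\cup\beta=A\times A$ and $\alpha\cap\beta=\Delta_A$. The direct product quasiorder is $\prod_{i\in I}\gamma_i=\{(\underline a,\underline b)\mid \underline a,\underline b\in\prod_{i\in I}A_i,\ (\underline a(i),\underline b(i))\in\gamma_i\text{ for all } i\in I\}$. A two-element chain is a two-element set with a linear order. -}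

module Defs where

open import Data.Fin.Base using (Fin)
open import Data.Product.Base using (Σ-syntax; _×_)
open import Function.Bundles using (Inverse)
open import Level using (Level; _⊔_; suc)
open import Relation.Binary.Bundles using (Preorder)
open import Relation.Binary.Core using (Rel; _⇔_)
open import Relation.Binary.Construct.Intersection using (_∩_)
open import Relation.Binary.Construct.Union using (_∪_)
open import Relation.Binary.Definitions using (Universal)
open import Relation.Binary.Structures using (IsPreorder; IsTotalOrder)
import Relation.Binary.PropositionalEquality as ≡
open import Relation.Nullary.Negation using (¬_)

private
  variable
    i c ℓ₁ ℓ₂ : Level

-- A quasiordered set (A , γ) is a Preorder: _≲_ is γ and _≈_ is equality of
-- elements, i.e. the diagonal Δ_A.  An explicit _≈_ lets equality on a
-- product be pointwise equality, without function extensionality.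

Nontrivial : Preorder c ℓ₁ ℓ₂ → Set (c ⊔ ℓ₁ ⊔ ℓ₂)
Nontrivial A = ¬ (_≈_ ⇔ _≲_) × ¬ Universal _≲_
  where open Preorder A

IsHalfSpace : Preorder c ℓ₁ ℓ₂ → Set (c ⊔ ℓ₁ ⊔ suc ℓ₂)
IsHalfSpace {ℓ₂ = ℓ₂} A =
  Σ[ β ∈ Rel Carrier ℓ₂ ]
    IsPreorder _≈_ β × Universal (_≲_ ∪ β) × ((_≲_ ∩ β) ⇔ _≈_)
  where open Preorder A

∏ : {I : Set i} → (I → Preorder c ℓ₁ ℓ₂) → Preorder (i ⊔ c) (i ⊔ ℓ₁) (i ⊔ ℓ₂)
∏ {I = I} A = record
  { Carrier    = (k : I) → Carrier (A k)
  ; _≈_        = λ a b → (k : I) → _≈_ (A k) (a k) (b k)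
  ; _≲_        = λ a b → (k : I) → _≲_ (A k) (a k) (b k)
  ; isPreorder = record
    { isEquivalence = record
      { refl  = λ k → Eq.refl (A k)
      ; sym   = λ p k → Eq.sym (A k) (p k)
      ; trans = λ p q k → Eq.trans (A k) (p k) (q k)
      }
    ; reflexive = λ p k → reflexive (A k) (p k)
    ; trans     = λ p q k → trans (A k) (p k) (q k)
    }
  }
  where open Preorder

IsTwoElementChain : Preorder c ℓ₁ ℓ₂ → Set (c ⊔ ℓ₁ ⊔ ℓ₂)
IsTwoElementChain A =
  Inverse Eq.setoid (≡.setoid (Fin 2)) × IsTotalOrder _≈_ _≲_
  where open Preorder A

{-# OPTIONS --safe #-}

-- Classically, a quasiorder is a half-space iff every u satisfies p ≲ u or
-- u ≲ q whenever p ≲ q and p ≉ q: the complementary quasiorder can only be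
-- the complement of ≲ together with the diagonal, and this condition is its
-- transitivity.  Apply the condition in a product to points p, q that differ
-- only at k.  If there is a second index j and c ≴ d in A j, then choosing
-- c, d as the j-th coordinates of p, u (or of u, q) rules out one of the
-- alternatives; hence the end points of a strict pair of A k are a least and
-- a greatest element, and A k is a two-element chain.  With a third index
-- both alternatives can be ruled out at once.

module Submission where

open import Defs
open import Axiom.ExcludedMiddle using (ExcludedMiddle)
open import Data.Fin.Base using (Fin; zero; suc)
open import Data.Product.Base using (_×_; _,_; ∃; proj₁; proj₂; uncurry)
open import Data.Sum.Base using (_⊎_; inj₁; inj₂; [_,_]′) renaming (map to map-⊎)
open import Function.Base using (_∘_)
open import Function.Bundles using (_⇔_; _↔_; Inverse; mk⇔; mk↔ₛ′)
open import Level using (Level; _⊔_; Lift; lift; lower)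
open import Relation.Binary.Bundles using (Preorder; Setoid)
open import Relation.Binary.Core using (Rel)
open import Relation.Binary.Definitions using (Decidable; DecidableEquality)
open import Relation.Binary.PropositionalEquality using (_≡_; _≢_; refl; sym; setoid)
open import Relation.Binary.Structures using (IsPreorder; IsTotalOrder)
open import Relation.Nullary.Decidable using (yes; no; True; toWitness; fromWitness; map′; decidable-stable)
open import Relation.Nullary.Negation using (¬_; contradiction)

private
  variable
    a b i c ℓ ℓ₁ ℓ₂ : Level

-- Classical reasoning across universe levels

lowerEM : ∀ a b → ExcludedMiddle (a ⊔ b) → ExcludedMiddle a
lowerEM a b em = map′ lower lift (em {Lift b _})

¬∀⇒∃¬ : ExcludedMiddle (a ⊔ b) → {X : Set a} {P : X → Set b} →
        ¬ (∀ x → P x) → ∃ λ x → ¬ P x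
¬∀⇒∃¬ {a} {b} em {P = P} ¬all with em {∃ λ x → ¬ P x}
... | yes w = w
... | no ¬w = contradiction
  (λ x → decidable-stable (lowerEM b a em) (λ ¬p → ¬w (x , ¬p))) ¬all

-- Setoids with at most two elements

Fin1-unique : (x y : Fin 1) → x ≡ y
Fin1-unique zero zero = refl

Fin2-exhausted : {x y : Fin 2} → x ≢ y → ∀ z → z ≡ x ⊎ z ≡ y
Fin2-exhausted {zero}     {zero}     x≢y z          = contradiction refl x≢y
Fin2-exhausted {zero}     {suc zero} x≢y zero       = inj₁ refl
Fin2-exhausted {zero}     {suc zero} x≢y (suc zero) = inj₂ refl
Fin2-exhausted {suc zero} {zero}     x≢y zero       = inj₂ refl
Fin2-exhausted {suc zero} {zero}     x≢y (suc zero) = inj₁ refl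
Fin2-exhausted {suc zero} {suc zero} x≢y z          = contradiction refl x≢y

module _ (S : Setoid c ℓ) where
  open Setoid S renaming (refl to ≈-refl; sym to ≈-sym; trans to ≈-trans)

  to-injective : ∀ {n} (e : Inverse S (setoid (Fin n))) {x y : Carrier} →
                 Inverse.to e x ≡ Inverse.to e y → x ≈ y
  to-injective e eq = ≈-trans (≈-sym (strictlyInverseʳ _)) (inverseʳ eq)
    where open Inverse e

  two-exhausted : Inverse S (setoid (Fin 2)) →
                  ∀ {x y} → ¬ x ≈ y → ∀ z → z ≈ x ⊎ z ≈ y
  two-exhausted e x≉y z =
    map-⊎ (to-injective e) (to-injective e)
      (Fin2-exhausted (x≉y ∘ to-injective e) (Inverse.to e z))

  inverse-Fin2 : Decidable _≈_ → ∀ {x y} → ¬ x ≈ y →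
                 (∀ z → z ≈ x ⊎ z ≈ y) → Inverse S (setoid (Fin 2))
  inverse-Fin2 _≈?_ {x} {y} x≉y exhausted = record
    { to        = to
    ; from      = from
    ; to-cong   = to-cong
    ; from-cong = λ { refl → ≈-refl }
    ; inverse   = (λ {n} z≈ → invˡ n z≈) , λ { {z} refl → invʳ z }
    }
    where
    to : Carrier → Fin 2
    to z with z ≈? x
    ... | yes _ = zero
    ... | no  _ = suc zero

    from : Fin 2 → Carrier
    from zero       = x
    from (suc zero) = y

    to-cong : ∀ {u v} → u ≈ v → to u ≡ to v
    to-cong {u} {v} u≈v with u ≈? x | v ≈? x
    ... | yes _   | yes _   = refl
    ... | yes u≈x | no  v≉x = contradiction (≈-trans (≈-sym u≈v) u≈x) v≉x
    ... | no  u≉x | yes v≈x = contradiction (≈-trans u≈v v≈x) u≉x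
    ... | no  _   | no  _   = refl

    invˡ : ∀ n {z} → z ≈ from n → to z ≡ n
    invˡ zero {z} z≈x with z ≈? x
    ... | yes _   = refl
    ... | no  z≉x = contradiction z≈x z≉x
    invˡ (suc zero) {z} z≈y with z ≈? x
    ... | yes z≈x = contradiction (≈-trans (≈-sym z≈x) z≈y) x≉y
    ... | no  _   = refl

    invʳ : ∀ z → from (to z) ≈ z
    invʳ z with z ≈? x
    ... | yes z≈x = ≈-sym z≈x
    ... | no  z≉x = [ (λ z≈x → contradiction z≈x z≉x) , ≈-sym ]′ (exhausted z)

-- Half-spaces and chains through strict pairs

module _ (A : Preorder c ℓ₁ ℓ₂) where
  open Preorder A renaming (trans to ≲-trans)

  StrictPairsCover : Set (c ⊔ ℓ₁ ⊔ ℓ₂)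
  StrictPairsCover = ∀ {p q} → p ≲ q → ¬ p ≈ q → ∀ u → p ≲ u ⊎ u ≲ q

  -- For nontrivial quasiorders this is, classically, the property of being a two-element chain:
  -- each strict pair consists of a least and a greatest element.
  StrictPairsBound : Set (c ⊔ ℓ₁ ⊔ ℓ₂)
  StrictPairsBound = ∀ {p q} → p ≲ q → ¬ p ≈ q → ∀ u → p ≲ u × u ≲ q

  -- When totality yields neither alternative, it puts (p, u) and (u, q) into `β`; transitivity
  -- gives (p, q), and together with p ≲ q this forces p ≈ q.
  isHalfSpace⇒cover : IsHalfSpace A → StrictPairsCover
  isHalfSpace⇒cover (β , isβ , total , ∩⇒≈ , _) {p} {q} p≲q p≉q u
    with total p u | total u q
  ... | inj₁ p≲u | _        = inj₁ p≲u
  ... | inj₂ _   | inj₁ u≲q = inj₂ u≲q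
  ... | inj₂ pβu | inj₂ uβq = contradiction (∩⇒≈ (p≲q , IsPreorder.trans isβ pβu uβq)) p≉q

  cover⇒isHalfSpace : Decidable _≈_ → Decidable _≲_ → StrictPairsCover → IsHalfSpace A
  cover⇒isHalfSpace _≈?_ _≲?_ cover =
    β , isPreorder-β , total ,
    (λ (x≲y , xβy) → toWitness (lower (xβy x≲y))) ,
    (λ x≈y → reflexive x≈y , λ _ → lift (fromWitness x≈y))
    where
    -- x ≈ y is stored as a decision because a half-space needs its
    -- complement at the level of _≲_, which may differ from that of _≈_.
    β : Rel Carrier _
    β x y = x ≲ y → Lift ℓ₂ (True (x ≈? y))

    -- If x ≲ z were strict, `cover` would compare y with one end point. `β` turns that comparison
    -- into ≈, so y also compares with the other end point, and `β` gives x ≈ z after all.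
    β-trans : ∀ {x y z} → β x y → β y z → β x z
    β-trans {x} {y} {z} xβy yβz x≲z with x ≈? z
    ... | yes _   = lift _
    ... | no  x≉z with cover x≲z x≉z y
    ...   | inj₁ x≲y = contradiction (Eq.trans x≈y (toWitness (lower (yβz y≲z)))) x≉z
      where
      x≈y = toWitness (lower (xβy x≲y))
      y≲z = ≲-trans (reflexive (Eq.sym x≈y)) x≲z
    ...   | inj₂ y≲z = contradiction (Eq.trans (toWitness (lower (xβy x≲y))) y≈z) x≉z
      where
      y≈z = toWitness (lower (yβz y≲z))
      x≲y = ≲-trans x≲z (reflexive (Eq.sym y≈z))

    isPreorder-β : IsPreorder _≈_ β
    isPreorder-β = record
      { isEquivalence = isEquivalence
      ; reflexive     = λ x≈y _ → lift (fromWitness x≈y)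
      ; trans         = β-trans
      }

    total : ∀ x y → x ≲ y ⊎ β x y
    total x y with x ≲? y
    ... | yes x≲y = inj₁ x≲y
    ... | no  x≴y = inj₂ (λ x≲y → contradiction x≲y x≴y)

  isTwoElementChain⇒bound : IsTwoElementChain A → StrictPairsBound
  isTwoElementChain⇒bound (e , _) p≲q p≉q u with two-exhausted Eq.setoid e p≉q u
  ... | inj₁ u≈p = reflexive (Eq.sym u≈p) , ≲-trans (reflexive u≈p) p≲q
  ... | inj₂ u≈q = ≲-trans p≲q (reflexive (Eq.sym u≈q)) , reflexive u≈q

  module _ (em : ExcludedMiddle (c ⊔ ℓ₁ ⊔ ℓ₂)) (nontrivial : Nontrivial A) where

    strictPair : ∃ λ p → ∃ λ q → p ≲ q × ¬ p ≈ q
    -- Quantifying over pairs bundled with a proof of p ≲ q lets the counterexample to p ≈ q carry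
    -- that proof.
    strictPair with ¬∀⇒∃¬ em {X = ∃ λ p → ∃ λ q → p ≲ q} {P = λ (p , q , _) → p ≈ q}
                      (λ ≲⇒≈ → proj₁ nontrivial (reflexive , λ p≲q → ≲⇒≈ (_ , _ , p≲q)))
    ... | (p , q , p≲q) , p≉q = p , q , p≲q , p≉q

    unrelatedPair : ∃ λ x → ∃ λ y → ¬ x ≲ y
    unrelatedPair with ¬∀⇒∃¬ (lowerEM (c ⊔ ℓ₂) ℓ₁ em) {P = uncurry _≲_}
                         (λ all → proj₂ nontrivial (λ x y → all (x , y)))
    ... | (x , y) , x≴y = x , y , x≴y

    bound⇒isTwoElementChain : StrictPairsBound → IsTwoElementChain A
    bound⇒isTwoElementChain bound =
      inverse-Fin2 Eq.setoid _≈?_ p≉q exhausted , record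
        { isPartialOrder = record { isPreorder = isPreorder ; antisym = antisym }
        ; total          = total
        }
      where
      _≈?_ : Decidable _≈_
      _ ≈? _ = lowerEM ℓ₁ (c ⊔ ℓ₂) em

      p   = proj₁ strictPair
      q   = proj₁ (proj₂ strictPair)
      p≲q = proj₁ (proj₂ (proj₂ strictPair))
      p≉q = proj₂ (proj₂ (proj₂ strictPair))

      -- If x and y were distinct, `bound` would give u ≲ y ≲ x ≲ v for all u and v, so ≲ would be
      -- universal.
      antisym : ∀ {x y} → x ≲ y → y ≲ x → x ≈ y
      antisym {x} {y} x≲y y≲x = decidable-stable (x ≈? y) λ x≉y →
        proj₂ nontrivial λ u v →
          ≲-trans (proj₂ (bound x≲y x≉y u)) (≲-trans y≲x (proj₁ (bound x≲y x≉y v)))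

      exhausted : ∀ u → u ≈ p ⊎ u ≈ q
      exhausted u with u ≈? p
      ... | yes u≈p = inj₁ u≈p
      -- Now p ≲ u is itself a strict pair, so u is a greatest element, just as q is.
      ... | no  u≉p = inj₂ (antisym
        (proj₂ (bound p≲q p≉q u))
        (proj₂ (bound (proj₁ (bound p≲q p≉q u)) (u≉p ∘ Eq.sym) q)))

      total : ∀ x y → x ≲ y ⊎ y ≲ x
      total x y with exhausted x
      ... | inj₁ x≈p = inj₁ (≲-trans (reflexive x≈p) (proj₁ (bound p≲q p≉q y)))
      ... | inj₂ x≈q = inj₂ (≲-trans (proj₂ (bound p≲q p≉q y)) (reflexive (Eq.sym x≈q)))

-- Products

module _ {I : Set i} (_≟_ : DecidableEquality I) {X : I → Set c} where

  update : (∀ k → X k) → (k : I) → X k → ∀ l → X l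
  update f k x l with k ≟ l
  ... | yes refl = x
  ... | no  _    = f l

  update-≡ : ∀ f k x → update f k x k ≡ x
  update-≡ f k x with k ≟ k
  ... | yes refl = refl
  ... | no  k≢k  = contradiction refl k≢k

  update-≢ : ∀ f {k l} x → k ≢ l → update f k x l ≡ f l
  update-≢ f {k} {l} x k≢l with k ≟ l
  ... | yes k≡l = contradiction k≡l k≢l
  ... | no  _   = refl

module _ {I : Set i} (A : I → Preorder c ℓ₁ ℓ₂) where
  module A k = Preorder (A k)
  open A using (Carrier)

  cover-∏-unique : (∀ k l → k ≡ l) → I →
                   (∀ k → StrictPairsCover (A k)) → StrictPairsCover (∏ A)
  cover-∏-unique unique k cover {p} {q} p≲q p≉q u =
    map-⊎ (everywhere (λ l → A._≲_ l (p l) (u l)))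
          (everywhere (λ l → A._≲_ l (u l) (q l)))
          (cover k (p≲q k) (p≉q ∘ everywhere (λ l → A._≈_ l (p l) (q l))) (u k))
    where
    everywhere : ∀ {ℓ} (P : I → Set ℓ) → P k → ∀ l → P l
    everywhere P pk l with refl ← unique k l = pk

  -- Suppose p ≲ u fails at l, and let p and q differ at k. In the chain at k, u lies between p and
  -- q, so k and l are distinct and exhaust the indices. At l, linearity gives u ≲ p ≲ q. Hence u ≲
  -- q at both.
  cover-∏-chains : ExcludedMiddle (i ⊔ ℓ₁ ⊔ ℓ₂) → I ↔ Fin 2 →
                   (∀ k → IsTwoElementChain (A k)) → StrictPairsCover (∏ A)
  cover-∏-chains em e chain {p} {q} p≲q p≉q u
    with lowerEM (i ⊔ ℓ₂) ℓ₁ em {∀ l → A._≲_ l (p l) (u l)}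
  ... | yes p≲u = inj₁ p≲u
  ... | no  p≴u
    with k , pk≉qk ← ¬∀⇒∃¬ (lowerEM (i ⊔ ℓ₁) ℓ₂ em) p≉q
       | l , pl≴ul ← ¬∀⇒∃¬ (lowerEM (i ⊔ ℓ₂) ℓ₁ em) p≴u
    = inj₂ λ m → [ (λ { refl → proj₂ uk-between })
                 , (λ { refl → A.trans l ul≲pl (p≲q l) }) ]′
                 (two-exhausted (setoid I) e k≢l m)
    where
    uk-between : A._≲_ k (p k) (u k) × A._≲_ k (u k) (q k)
    uk-between = isTwoElementChain⇒bound (A k) (chain k) (p≲q k) pk≉qk (u k)

    k≢l : k ≢ l
    k≢l refl = pl≴ul (proj₁ uk-between)

    ul≲pl : A._≲_ l (u l) (p l)
    ul≲pl with IsTotalOrder.total (proj₂ (chain l)) (p l) (u l)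
    ... | inj₁ pl≲ul = contradiction pl≲ul pl≴ul
    ... | inj₂ ul≲pl = ul≲pl

  module _ (_≟_ : DecidableEquality I) where

    private
      _[_≔_] : (∀ k → Carrier k) → (k : I) → Carrier k → ∀ l → Carrier l
      _[_≔_] = update _≟_

    update-≲⁻-≡ : ∀ f g k {x y} →
           (∀ l → A._≲_ l ((f [ k ≔ x ]) l) ((g [ k ≔ y ]) l)) → A._≲_ k x y
    update-≲⁻-≡ f g k {x} {y} r with e ← r k
      rewrite update-≡ _≟_ f k x | update-≡ _≟_ g k y = e

    update-≲⁻-≢ : ∀ f g {k l} {x y} → k ≢ l →
           (∀ m → A._≲_ m ((f [ k ≔ x ]) m) ((g [ k ≔ y ]) m)) → A._≲_ l (f l) (g l)
    update-≲⁻-≢ f g {k} {l} {x} {y} k≢l r with e ← r l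
      rewrite update-≢ _≟_ f x k≢l | update-≢ _≟_ g y k≢l = e

    module _ (cover : StrictPairsCover (∏ A)) where

      -- A strict pair of `A k` stays strict in the product when all other coordinates agree. The
      -- common coordinates `f` and the point `u` remain free, to be chosen so that an alternative
      -- fails.
      cover-at : ∀ k {x y} → A._≲_ k x y → ¬ A._≈_ k x y →
                 ∀ f u → (∀ l → A._≲_ l ((f [ k ≔ x ]) l) (u l)) ⊎
                         (∀ l → A._≲_ l (u l) ((f [ k ≔ y ]) l))
      cover-at k {x} {y} x≲y x≉y f = cover below different
        where
        below : ∀ l → A._≲_ l ((f [ k ≔ x ]) l) ((f [ k ≔ y ]) l)
        below l with k ≟ l
        ... | yes refl = x≲y
        ... | no  _    = A.refl l

        different : ¬ (∀ l → A._≈_ l ((f [ k ≔ x ]) l) ((f [ k ≔ y ]) l))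
        different eq with e ← eq k
          rewrite update-≡ _≟_ f k x | update-≡ _≟_ f k y = x≉y e

      -- The intermediate point agrees with `f` away from k, and either alternative is read off at
      -- k.
      cover-component : (∀ k → Carrier k) → ∀ k → StrictPairsCover (A k)
      cover-component f k x≲y x≉y u =
        map-⊎ (update-≲⁻-≡ f f k) (update-≲⁻-≡ f f k) (cover-at k x≲y x≉y f (f [ k ≔ u ]))

      module _ (s t : ∀ k → Carrier k) (s≴t : ∀ k → ¬ A._≲_ k (s k) (t k)) where

        -- With common coordinates `t` and an intermediate point taken from `s`, the second
        -- alternative would give s ≲ t at l, so the first holds. Exchanging `s` and `t` leaves only
        -- the second.
        bound-component : ∀ {k l} → k ≢ l → StrictPairsBound (A k)
        bound-component {k} {l} k≢l {x} {y} x≲y x≉y u = x≲u , u≲y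
          where
          x≲u : A._≲_ k x u
          x≲u with cover-at k x≲y x≉y t (s [ k ≔ u ])
          ... | inj₁ r = update-≲⁻-≡ t s k r
          ... | inj₂ r = contradiction (update-≲⁻-≢ s t k≢l r) (s≴t l)

          u≲y : A._≲_ k u y
          u≲y with cover-at k x≲y x≉y s (t [ k ≔ u ])
          ... | inj₁ r = contradiction (update-≲⁻-≢ s t k≢l r) (s≴t l)
          ... | inj₂ r = update-≲⁻-≡ t s k r

        -- Exchanging `s` and `t` at m alone makes the first alternative fail at l and the second at
        -- m.
        no-third-index : ∀ {k l m} → k ≢ l → k ≢ m → m ≢ l →
                         ∀ {x y} → A._≲_ k x y → ¬ ¬ A._≈_ k x y
        no-third-index {k} {l} {m} k≢l k≢m m≢l {x} {y} x≲y x≉y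
          with cover-at k x≲y x≉y (s [ m ≔ t m ]) (t [ m ≔ s m ])
        ... | inj₁ r with e ← r l
          rewrite update-≢ _≟_ (s [ m ≔ t m ]) x k≢l
                | update-≢ _≟_ s (t m) m≢l
                | update-≢ _≟_ t (s m) m≢l = s≴t l e
        ... | inj₂ r with e ← r m
          rewrite update-≢ _≟_ (s [ m ≔ t m ]) y k≢m
                | update-≡ _≟_ s m (t m)
                | update-≡ _≟_ t m (s m) = s≴t m e

-- The equivalence, by the number of indices

theorem3p4 : ∀ {i c ℓ₁ ℓ₂ : Level} →
    ExcludedMiddle (i ⊔ c ⊔ ℓ₁ ⊔ ℓ₂) →
    (I : Set i) → I →
    (A : I → Preorder c ℓ₁ ℓ₂) →
    (∀ k → Nontrivial (A k)) →
    IsHalfSpace (∏ A) ⇔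
    (((I ↔ Fin 1) × (∀ k → IsHalfSpace (A k))) ⊎
    ((I ↔ Fin 2) × (∀ k → IsTwoElementChain (A k))))
theorem3p4 {i} {c} {ℓ₁} {ℓ₂} em I k₀ A nontrivial = mk⇔ forward backward
  where
  module P k = Preorder (A k)
  open P using (Carrier)

  em-A : ExcludedMiddle (c ⊔ ℓ₁ ⊔ ℓ₂)
  em-A = lowerEM (c ⊔ ℓ₁ ⊔ ℓ₂) i em

  em-∏≈ : ExcludedMiddle (i ⊔ ℓ₁)
  em-∏≈ = lowerEM (i ⊔ ℓ₁) (c ⊔ ℓ₂) em

  em-∏≲ : ExcludedMiddle (i ⊔ ℓ₂)
  em-∏≲ = lowerEM (i ⊔ ℓ₂) (c ⊔ ℓ₁) em

  em-I : ExcludedMiddle i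
  em-I = lowerEM i (c ⊔ ℓ₁ ⊔ ℓ₂) em

  _≟_ : DecidableEquality I
  _ ≟ _ = em-I

  s t : ∀ k → Carrier k
  s k = proj₁ (unrelatedPair (A k) em-A (nontrivial k))
  t k = proj₁ (proj₂ (unrelatedPair (A k) em-A (nontrivial k)))

  s≴t : ∀ k → ¬ P._≲_ k (s k) (t k)
  s≴t k = proj₂ (proj₂ (unrelatedPair (A k) em-A (nontrivial k)))

  forward : IsHalfSpace (∏ A) →
    ((I ↔ Fin 1) × (∀ k → IsHalfSpace (A k))) ⊎
    ((I ↔ Fin 2) × (∀ k → IsTwoElementChain (A k)))
  forward halfSpace with em-I {∃ λ l → k₀ ≢ l}
  ... | no ¬other = inj₁
      ( mk↔ₛ′ (λ _ → zero) (λ _ → k₀) (Fin1-unique zero) only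
      , λ k → cover⇒isHalfSpace (A k)
          (λ _ _ → lowerEM ℓ₁ (c ⊔ ℓ₂) em-A) (λ _ _ → lowerEM ℓ₂ (c ⊔ ℓ₁) em-A)
          -- Restricting to `A k` takes a base point of the product; `s` is one.
          (cover-component A _≟_ (isHalfSpace⇒cover (∏ A) halfSpace) s k))
    where
    only : ∀ k → k₀ ≡ k
    only k = decidable-stable (k₀ ≟ k) (λ k₀≢k → ¬other (k , k₀≢k))
  ... | yes (k₁ , k₀≢k₁) = inj₂
      ( inverse-Fin2 (setoid I) _≟_ k₀≢k₁ exhausted
      , λ k → bound⇒isTwoElementChain (A k) em-A (nontrivial k)
          (bound-component A _≟_ cover s t s≴t (proj₂ (another k))))
    where
    cover : StrictPairsCover (∏ A)
    cover = isHalfSpace⇒cover (∏ A) halfSpace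

    exhausted : ∀ k → k ≡ k₀ ⊎ k ≡ k₁
    exhausted k with k ≟ k₀ | k ≟ k₁ | strictPair (A k) em-A (nontrivial k)
    ... | yes k≡k₀ | _        | _ = inj₁ k≡k₀
    ... | no  _    | yes k≡k₁ | _ = inj₂ k≡k₁
    -- A strict pair at a third index k is refuted at the coordinates `k₁` and `k₀`.
    ... | no  k≢k₀ | no  k≢k₁ | _ , _ , x≲y , x≉y =
      contradiction x≉y (no-third-index A _≟_ cover s t s≴t k≢k₁ k≢k₀ k₀≢k₁ x≲y)

    another : ∀ k → ∃ λ l → k ≢ l
    another k with k ≟ k₁
    ... | yes refl = k₀ , k₀≢k₁ ∘ sym
    ... | no  k≢k₁ = k₁ , k≢k₁

  backward :
    ((I ↔ Fin 1) × (∀ k → IsHalfSpace (A k))) ⊎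
    ((I ↔ Fin 2) × (∀ k → IsTwoElementChain (A k))) →
    IsHalfSpace (∏ A)
  -- Both cases reduce to the cover condition on the product.
  backward = cover⇒isHalfSpace (∏ A) (λ _ _ → em-∏≈) (λ _ _ → em-∏≲) ∘
    [ (λ (e , halfSpace) → cover-∏-unique A
         (λ k l → to-injective (setoid I) e (Fin1-unique _ _)) k₀
         (λ k → isHalfSpace⇒cover (A k) (halfSpace k)))
    , (λ (e , chain) →
         cover-∏-chains A (lowerEM (i ⊔ ℓ₁ ⊔ ℓ₂) c em) e chain) ]′
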